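{- If $G$ is a complete $k$-partite graph with $k\ge 3$, then $G$ is antimagic.
   Context: All graphs are finite, undirected and simple. A complete $k$-partite graph is a graph whose vertex set can be partitioned into $k$ nonempty classes such that two vertices are adjacent if and only if they belong to different classes. An antimagic labeling of a graph with $m$ edges and $n$ vertices is a bijection from the set of edges to the integers $\{1,\ldots,m\}$ such that all $n$ vertex sums are pairwise distinct, where a vertex sum is the sum of the labels of all edges incident with that vertex. A graph is called antimagic if it has an antimagic labeling. -}

module Defs where

open import Data.Fin using (Fin; toℕ; _<_)
open import Data.Fin.Properties using (_≟_; _<?_)
open import Data.List using (List; []; _∷_; map; filter; length; mapMaybe; allFin; cartesianProduct)
open import Data.List.Membership.Propositional using (_∈_)
open import Data.List.Membership.Propositional.Properties using (∈-allFin; ∈-cartesianProduct⁺)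
open import Data.List.Relation.Unary.All using (All; []; _∷_)
open import Data.List.Relation.Unary.AllPairs using ([]; _∷_)
open import Data.List.Relation.Unary.Any using (here; there)
open import Data.List.Relation.Unary.Unique.Propositional using (Unique)
open import Data.List.Relation.Unary.Unique.Propositional.Properties using (allFin⁺; cartesianProduct⁺)
open import Data.Maybe using (Maybe; just; nothing)
open import Data.Nat using (ℕ; suc)
open import Data.Nat.ListAction using (sum)
open import Data.Product using (Σ; _×_; _,_)
open import Data.Sum using (_⊎_)
open import Function.Bundles using (_⤖_; _⇔_; Bijection)
open import Function.Definitions using (Injective; Surjective)
open import Level using (0ℓ)
open import Relation.Binary.Core using (Rel)
open import Relation.Binary.Definitions using (Decidable; Irreflexive; Symmetric)
open import Relation.Binary.PropositionalEquality using (_≡_; _≢_; refl; sym; trans)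
open import Relation.Nullary using (Dec; yes; no; contradiction)
open import Relation.Nullary.Decidable using (_⊎-dec_; _×-dec_; recompute)

record Graph (n : ℕ) : Set₁ where
  field
    Adj    : Rel (Fin n) 0ℓ
    adj?   : Decidable Adj
    symm   : Symmetric Adj
    irrefl : Irreflexive _≡_ Adj

open Graph public

-- An undirected edge {u , v} is represented by its endpoints in increasing
-- order.  The proof fields are irrelevant, so an edge is determined by its
-- endpoints and there are no parallel edges.
record Edge {n : ℕ} (G : Graph n) : Set where
  constructor edge
  field
    lo hi  : Fin n
    .lo<hi : lo < hi
    .adj   : Adj G lo hi

open Edge public

Incident : ∀ {n} {G : Graph n} → Fin n → Edge G → Set
Incident v e = v ≡ lo e ⊎ v ≡ hi e

incident? : ∀ {n} {G : Graph n} (v : Fin n) (e : Edge G) → Dec (Incident v e)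
incident? v e = (v ≟ lo e) ⊎-dec (v ≟ hi e)

toEdge : ∀ {n} (G : Graph n) → Fin n × Fin n → Maybe (Edge G)
toEdge G (u , v) with (u <? v) ×-dec adj? G u v
... | yes (u<v , a) = just (edge u v u<v a)
... | no _          = nothing

-- Every edge occurs exactly once: see edges-complete and edges-unique.
edges : ∀ {n} (G : Graph n) → List (Edge G)
edges {n} G = mapMaybe (toEdge G) (cartesianProduct (allFin n) (allFin n))

size : ∀ {n} → Graph n → ℕ
size G = length (edges G)

vertexSum : ∀ {n} (G : Graph n) → (Edge G → ℕ) → Fin n → ℕ
vertexSum G label v = sum (map label (filter (incident? v) (edges G)))

record AntimagicLabeling {n : ℕ} (G : Graph n) : Set where
  field
    labeling : Edge G ⤖ Fin (size G)

  -- Fin m is {0 , … , m - 1}; the labels are 1 , … , m.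
  label : Edge G → ℕ
  label e = suc (toℕ (Bijection.to labeling e))

  field
    sums-distinct : Injective _≡_ _≡_ (vertexSum G label)

Antimagic : ∀ {n} → Graph n → Set
Antimagic G = AntimagicLabeling G

-- A partition of the vertices into k nonempty classes is a surjection onto Fin k.
CompletePartite : ∀ {n} → ℕ → Graph n → Set
CompletePartite {n} k G =
  Σ (Fin n → Fin k) λ class →
    Surjective _≡_ _≡_ class × (∀ u v → Adj G u v ⇔ class u ≢ class v)

private
  toEdge-just : ∀ {n} (G : Graph n) (e : Edge G) → toEdge G (lo e , hi e) ≡ just e
  toEdge-just G (edge u v l a) with (u <? v) ×-dec adj? G u v
  ... | yes _ = refl
  ... | no ¬p = contradiction (recompute (u <? v) l , recompute (adj? G u v) a) ¬p

  toEdge-ends : ∀ {n} (G : Graph n) p {e : Edge G} → toEdge G p ≡ just e → p ≡ (lo e , hi e)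
  toEdge-ends G (u , v) eq with (u <? v) ×-dec adj? G u v
  toEdge-ends G (u , v) refl | yes _ = refl
  toEdge-ends G (u , v) ()   | no _

  ∈-mapMaybe : ∀ {A B : Set} (f : A → Maybe B) {x y} xs →
               x ∈ xs → f x ≡ just y → y ∈ mapMaybe f xs
  ∈-mapMaybe f (x ∷ xs) (here refl) eq with f x
  ∈-mapMaybe f (x ∷ xs) (here refl) refl | just _ = here refl
  ∈-mapMaybe f (x ∷ xs) (there i) eq with f x
  ... | just _  = there (∈-mapMaybe f xs i eq)
  ... | nothing = ∈-mapMaybe f xs i eq

  All-mapMaybe : ∀ {n} (G : Graph n) {p e} → toEdge G p ≡ just e →
                 ∀ ps → All (p ≢_) ps → All (e ≢_) (mapMaybe (toEdge G) ps)
  All-mapMaybe G eq [] [] = []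
  All-mapMaybe G {p} eq (q ∷ ps) (p≢q ∷ r) with toEdge G q in eq′
  ... | nothing = All-mapMaybe G eq ps r
  ... | just _  =
    (λ { refl → p≢q (trans (toEdge-ends G p eq) (sym (toEdge-ends G q eq′))) })
    ∷ All-mapMaybe G eq ps r

  Unique-mapMaybe : ∀ {n} (G : Graph n) ps → Unique ps → Unique (mapMaybe (toEdge G) ps)
  Unique-mapMaybe G [] [] = []
  Unique-mapMaybe G (p ∷ ps) (h ∷ u) with toEdge G p in eq
  ... | nothing = Unique-mapMaybe G ps u
  ... | just _  = All-mapMaybe G eq ps h ∷ Unique-mapMaybe G ps u

edges-complete : ∀ {n} (G : Graph n) (e : Edge G) → e ∈ edges G
edges-complete G e =
  ∈-mapMaybe (toEdge G) _
    (∈-cartesianProduct⁺ (∈-allFin (lo e)) (∈-allFin (hi e))) (toEdge-just G e)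

edges-unique : ∀ {n} (G : Graph n) → Unique (edges G)
edges-unique {n} G = Unique-mapMaybe G _ (cartesianProduct⁺ (allFin⁺ n) (allFin⁺ n))

{-# OPTIONS --safe #-}

-- Let A be a smallest class, of size a, let B be the set of the b other
-- vertices, and let m be the number of edges inside B.  Label those edges
-- 1 , … , m in any order, and enumerate B as β 0 , β 1 , … by increasing
-- partial sum; the edge from β j to the i-th vertex of A gets m + a j + i + 1.
-- Then the sums are increasing along A and along B.  Moreover a vertex of B with
-- d neighbours in B has a partial sum of at most d m - d (d - 1) / 2, its labels
-- being distinct, and a ≤ d (here k ≥ 3 is used) and a + d ≤ b: this
-- makes every sum in A exceed every sum in B.

module Submission where

open import Defs
open import Data.Nat using (ℕ; _≥_)

open import Data.Fin as Fin using (Fin; toℕ; combine; punchIn; punchOut)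
import Data.Fin.Properties as Fin
open import Data.Fin.Permutation using (↔⇒≡)
open import Data.List using (List; []; _∷_; _++_; map; filter; length; lookup; tabulate; allFin)
open import Data.List.Extrema.Nat using (argmin; f[argmin]≤f[xs])
open import Data.List.Membership.Propositional using (_∈_)
open import Data.List.Membership.Propositional.Properties
  using (∈-∃++; ∈-allFin; ∈-filter⁺; ∈-filter⁻; ∈-lookup; ∈-map⁺; ∈-map⁻; ∈-++⁺ˡ; ∈-++⁺ʳ; ∈-++⁻)
open import Data.List.Membership.Propositional.Properties.WithK using (unique∧set⇒bag)
open import Data.List.Properties using (map-∘; map-++; map-cong; map-tabulate; tabulate-cong; length-map)
open import Data.List.Relation.Binary.BagAndSetEquality using (∼bag⇒↭)
open import Data.List.Relation.Binary.Permutation.Propositional using (_↭_; ↭⇒↭ₛ; ↭-sym)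
open import Data.List.Relation.Binary.Permutation.Propositional.Properties
  using (∈-resp-↭; All-resp-↭; shift; ↭-length)
  renaming (map⁺ to ↭-map⁺)
import Data.List.Relation.Binary.Permutation.Setoid.Properties as Permₛ
open import Data.List.Relation.Unary.All as All using (All; []; _∷_)
open import Data.List.Relation.Unary.All.Properties using (map⁺)
open import Data.List.Relation.Unary.AllPairs using ([]; _∷_)
open import Data.List.Relation.Unary.Any using (index)
open import Data.List.Relation.Unary.Any.Properties using (lookup-index)
open import Data.List.Relation.Unary.Sorted.TotalOrder using (Sorted)
open import Data.List.Relation.Unary.Sorted.TotalOrder.Properties using (lookup-mono-≤)
open import Data.List.Relation.Unary.Unique.Propositional using (Unique)
import Data.List.Relation.Unary.Unique.Propositional.Properties as Unique
import Data.List.Sort as Sort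
open import Data.Nat as ℕ using (zero; suc; s≤s; z≤n; _+_; _*_; _≤_; _<_)
open import Data.Nat.ListAction using (sum)
open import Data.Nat.ListAction.Properties using (sum-++; sum-↭)
import Data.Nat.Properties as ℕ
open import Data.List.Membership.DecPropositional ℕ._≟_ using (_∈?_)
open import Data.Nat.Tactic.RingSolver using (solve-∀)
open import Data.Product as Product using (Σ; ∃; _×_; _,_; proj₁; proj₂)
open import Data.Sum using (_⊎_; inj₁; inj₂)
open import Data.Sum.Function.Propositional using (_⊎-↔_)
open import Function.Base using (_∘_)
open import Function.Bundles using (_↔_; _⇔_; Inverse; Equivalence; mk↔ₛ′; mk⇔)
open import Function.Definitions using (Injective)
open import Function.Properties.Inverse using (↔-refl; ↔-trans; ↔-sym; ↔⇒⤖)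
open import Relation.Binary.Bundles using (DecTotalOrder)
import Relation.Binary.Construct.On as On
open import Relation.Binary.Definitions using (Tri; tri<; tri≈; tri>)
open import Relation.Binary.PropositionalEquality
open import Relation.Nullary using (Dec; ¬_; yes; no; contradiction)
open import Relation.Nullary.Decidable using (recompute; _×-dec_; ¬?)
open import Relation.Unary using (Decidable)

private
  variable
    A B : Set
    n : ℕ

lookup-injective : {xs : List A} → Unique xs → ∀ {i j} → lookup xs i ≡ lookup xs j → i ≡ j
lookup-injective (_ ∷ _) {Fin.zero}  {Fin.zero}  _  = refl
lookup-injective (p ∷ _) {Fin.zero}  {Fin.suc j} eq = contradiction eq (All.lookup p (∈-lookup j))
lookup-injective (p ∷ _) {Fin.suc i} {Fin.zero}  eq = contradiction (sym eq) (All.lookup p (∈-lookup i))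
lookup-injective (_ ∷ u) {Fin.suc i} {Fin.suc j} eq = cong Fin.suc (lookup-injective u eq)

Unique-resp-↭ : {xs ys : List A} → xs ↭ ys → Unique xs → Unique ys
Unique-resp-↭ p = Permₛ.Unique-resp-↭ (setoid _) (↭⇒↭ₛ p)

unique-set⇒↭ : {xs ys : List A} → Unique xs → Unique ys →
               (∀ {x} → x ∈ xs → x ∈ ys) → (∀ {x} → x ∈ ys → x ∈ xs) → xs ↭ ys
unique-set⇒↭ u v f g = ∼bag⇒↭ (unique∧set⇒bag u v (mk⇔ f g))

length-≤ : {xs : List A} {ys : List B} (R : A → B → Set) → Unique xs →
           (∀ {x} → x ∈ xs → ∃ λ y → y ∈ ys × R x y) →
           (∀ {x x′ y} → R x y → R x′ y → x ≡ x′) →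
           length xs ≤ length ys
length-≤ {xs = xs} {ys} R u f R-inj = Fin.injective⇒≤ {f = h} h-injective
  where
  h : Fin (length xs) → Fin (length ys)
  h i = index (proj₁ (proj₂ (f (∈-lookup i))))

  h-R : ∀ i → R (lookup xs i) (lookup ys (h i))
  h-R i with f (∈-lookup i)
  ... | y , y∈ , r = subst (R (lookup xs i)) (lookup-index y∈) r

  h-injective : ∀ {i j} → h i ≡ h j → i ≡ j
  h-injective {i} {j} eq =
    lookup-injective u (R-inj (h-R i) (subst (R (lookup xs j) ∘ lookup ys) (sym eq) (h-R j)))

length-filter-complement : {P : A → Set} (P? : Decidable P) (xs : List A) →
  length (filter P? xs) + length (filter (¬? ∘ P?) xs) ≡ length xs
length-filter-complement P? [] = refl
length-filter-complement P? (x ∷ xs) with P? x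
... | yes _ = cong suc (length-filter-complement P? xs)
... | no  _ = trans (ℕ.+-suc _ _) (cong suc (length-filter-complement P? xs))

sum-arithmetic : ∀ n c p →
  2 * sum (map (λ i → c + p * toℕ i) (allFin n)) + p * n ≡ 2 * n * c + p * n * n
sum-arithmetic n c p = trans (cong (λ l → 2 * sum l + p * n) (map-tabulate {n = n} (λ i → i) _)) (go n c)
  where
  alg₁ : ∀ c p n s → 2 * ((c + p * 0) + s) + p * suc n ≡ 2 * c + p + (2 * s + p * n)
  alg₁ = solve-∀
  alg₂ : ∀ c p n → 2 * c + p + (2 * n * (c + p) + p * n * n) ≡ 2 * suc n * c + p * suc n * suc n
  alg₂ = solve-∀
  alg₃ : ∀ c p i → c + p * suc i ≡ (c + p) + p * i
  alg₃ = solve-∀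

  go : ∀ n c → 2 * sum (tabulate {n = n} (λ i → c + p * toℕ i)) + p * n ≡ 2 * n * c + p * n * n
  go zero    c = trans (ℕ.*-zeroʳ p) (sym (ℕ.*-zeroʳ (p * 0)))
  go (suc n) c = begin
    2 * ((c + p * 0) + sum (tabulate {n = n} (λ i → c + p * suc (toℕ i)))) + p * suc n
      ≡⟨ cong (λ l → 2 * ((c + p * 0) + sum l) + p * suc n) (tabulate-cong {n = n} (λ i → alg₃ c p (toℕ i))) ⟩
    2 * ((c + p * 0) + sum (tabulate {n = n} (λ i → c + p + p * toℕ i))) + p * suc n
      ≡⟨ alg₁ c p n _ ⟩
    2 * c + p + (2 * sum (tabulate {n = n} (λ i → c + p + p * toℕ i)) + p * n)
      ≡⟨ cong (2 * c + p +_) (go n (c + p)) ⟩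
    2 * c + p + (2 * n * (c + p) + p * n * n)
      ≡⟨ alg₂ c p n ⟩
    2 * suc n * c + p * suc n * suc n ∎
    where open ≡-Reasoning

-- The extremal list is m - 1 , m - 2 , … , m - d, where d is the length.
sum-unique-bounded : ∀ m {xs} → Unique xs → All (_< m) xs →
  2 * sum xs + length xs * suc (length xs) ≤ 2 * length xs * m
sum-unique-bounded m [] [] = z≤n
sum-unique-bounded zero (_ ∷ _) (() ∷ _)
sum-unique-bounded (suc m) {xs@(_ ∷ _)} u all with m ∈? xs
... | no m∉ = ℕ.≤-trans (sum-unique-bounded m u (All.tabulate λ x∈ →
                ℕ.≤∧≢⇒< (ℕ.s≤s⁻¹ (All.lookup all x∈)) λ { refl → m∉ x∈ }))
              (ℕ.*-monoʳ-≤ (2 * length xs) (ℕ.n≤1+n m))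
... | yes m∈ with ys , zs , eq ← ∈-∃++ m∈ = subst₂ _≤_ lhs rhs
                (ℕ.+-monoʳ-≤ (2 * m + 2 * (length r + 1)) (sum-unique-bounded m u-r all-r))
  where
  r = ys ++ zs
  p : xs ↭ m ∷ r
  p = subst (_↭ m ∷ r) (sym eq) (shift m ys zs)
  all-p : All (_< suc m) (m ∷ r)
  all-p = All-resp-↭ p all
  u-p : Unique (m ∷ r)
  u-p = Unique-resp-↭ p u
  u-r : Unique r
  u-r with u-p
  ... | _ ∷ v = v
  all-r : All (_< m) r
  all-r with all-p | u-p
  ... | _ ∷ a | m∉ ∷ _ = All.zipWith (λ { (lt , ne) → ℕ.≤∧≢⇒< (ℕ.s≤s⁻¹ lt) (ne ∘ sym) }) (a , m∉)
  alg₁ : ∀ m s d → 2 * m + 2 * (d + 1) + (2 * s + d * suc d) ≡ 2 * (m + s) + suc d * suc (suc d)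
  alg₁ = solve-∀
  alg₂ : ∀ m d → 2 * m + 2 * (d + 1) + 2 * d * m ≡ 2 * suc d * suc m
  alg₂ = solve-∀
  lhs = trans (alg₁ m (sum r) (length r))
    (sym (cong₂ (λ s l → 2 * s + l * suc l) (sum-↭ p) (↭-length p)))
  rhs = trans (alg₂ m (length r)) (sym (cong (λ l → 2 * l * suc m) (↭-length p)))

module _ (G : Graph n) where

  edge-between : ∀ u v → Adj G u v → Σ (Edge G) λ e → Incident u e × Incident v e
  edge-between u v uv with Fin.<-cmp u v
  ... | tri< u<v _ _ = edge u v u<v uv , inj₁ refl , inj₂ refl
  ... | tri≈ _ u≡v _ = contradiction uv (irrefl G u≡v)
  ... | tri> _ _ v<u = edge v u v<u (symm G uv) , inj₂ refl , inj₁ refl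

  ends-unique : ∀ {u v} → u ≢ v → (e e′ : Edge G) →
                Incident u e → Incident v e → Incident u e′ → Incident v e′ → e ≡ e′
  ends-unique u≢v (edge _ _ _ _) (edge _ _ _ _) (inj₁ refl) (inj₁ refl) _ _ = contradiction refl u≢v
  ends-unique u≢v (edge _ _ _ _) (edge _ _ _ _) (inj₂ refl) (inj₂ refl) _ _ = contradiction refl u≢v
  ends-unique u≢v (edge _ _ _ _) (edge _ _ _ _) _ _ (inj₁ refl) (inj₁ refl) = contradiction refl u≢v
  ends-unique u≢v (edge _ _ _ _) (edge _ _ _ _) _ _ (inj₂ refl) (inj₂ refl) = contradiction refl u≢v
  ends-unique u≢v (edge _ _ _ _) (edge _ _ _ _) (inj₁ refl) (inj₂ refl) (inj₁ refl) (inj₂ refl) = refl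
  ends-unique u≢v (edge _ _ _ _) (edge _ _ _ _) (inj₂ refl) (inj₁ refl) (inj₂ refl) (inj₁ refl) = refl
  ends-unique u≢v (edge _ _ l _) (edge _ _ l′ _) (inj₁ refl) (inj₂ refl) (inj₂ refl) (inj₁ refl) =
    contradiction (recompute (_ Fin.<? _) l′) (Fin.<-asym (recompute (_ Fin.<? _) l))
  ends-unique u≢v (edge _ _ l _) (edge _ _ l′ _) (inj₂ refl) (inj₁ refl) (inj₁ refl) (inj₂ refl) =
    contradiction (recompute (_ Fin.<? _) l′) (Fin.<-asym (recompute (_ Fin.<? _) l))

  incident-ends : ∀ {u v w} (e : Edge G) → u ≢ v →
                  Incident u e → Incident v e → Incident w e → w ≡ u ⊎ w ≡ v
  incident-ends e u≢v (inj₁ p) (inj₁ q) _        = contradiction (trans p (sym q)) u≢v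
  incident-ends e u≢v (inj₂ p) (inj₂ q) _        = contradiction (trans p (sym q)) u≢v
  incident-ends e u≢v (inj₁ p) _        (inj₁ r) = inj₁ (trans r (sym p))
  incident-ends e u≢v (inj₂ p) _        (inj₂ r) = inj₁ (trans r (sym p))
  incident-ends e u≢v _        (inj₁ q) (inj₁ r) = inj₂ (trans r (sym q))
  incident-ends e u≢v _        (inj₂ q) (inj₂ r) = inj₂ (trans r (sym q))

  incident-other : ∀ {v} (e : Edge G) → Incident v e → ∃ λ u → Incident u e × Adj G u v
  incident-other e@(edge _ _ _ uv) (inj₁ refl) = hi e , inj₂ refl , symm G (recompute (adj? G _ _) uv)
  incident-other e@(edge _ _ _ uv) (inj₂ refl) = lo e , inj₁ refl , recompute (adj? G _ _) uv

  Edge↔Fin : Edge G ↔ Fin (size G)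
  Edge↔Fin = mk↔ₛ′ (index ∘ edges-complete G) (lookup (edges G))
    (λ i → lookup-injective (edges-unique G) (sym (lookup-index (edges-complete G _))))
    (λ e → sym (lookup-index (edges-complete G e)))

  antimagic : ∀ {N} (φ : Edge G ↔ Fin N) →
              Injective _≡_ _≡_ (vertexSum G (suc ∘ toℕ ∘ Inverse.to φ)) → Antimagic G
  antimagic φ inj with refl ← ↔⇒≡ (↔-trans (↔-sym φ) Edge↔Fin) =
    record { labeling = ↔⇒⤖ φ ; sums-distinct = inj }

  vertexSum-reindex : ∀ {X : Set} (g : X → Edge G) → Injective _≡_ _≡_ g →
    (∀ e → ∃ λ x → e ≡ g x) → (ℓ : Edge G → ℕ) (v : Fin n) (xs : List X) → Unique xs →
    (∀ {x} → x ∈ xs → Incident v (g x)) → (∀ {x} → Incident v (g x) → x ∈ xs) →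
    vertexSum G ℓ v ≡ sum (map (ℓ ∘ g) xs)
  vertexSum-reindex g g-inj g-sur ℓ v xs u sound complete =
    trans (sum-↭ (↭-map⁺ ℓ p)) (cong sum (sym (map-∘ xs)))
    where
    p : filter (incident? v) (edges G) ↭ map g xs
    p = unique-set⇒↭ (Unique.filter⁺ (incident? v) (edges-unique G)) (Unique.map⁺ g-inj u) to from
      where
      to : ∀ {e} → e ∈ filter (incident? v) (edges G) → e ∈ map g xs
      to {e} e∈ with x , refl ← g-sur e =
        ∈-map⁺ g (complete (proj₂ (∈-filter⁻ (incident? v) {xs = edges G} e∈)))
      from : ∀ {e} → e ∈ map g xs → e ∈ filter (incident? v) (edges G)
      from e∈ with x , x∈ , refl ← ∈-map⁻ g e∈ =
        ∈-filter⁺ (incident? v) (edges-complete G (g x)) (sound x∈)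

row-exceeds-column : ∀ {a b d m i j s R C} → 1 ≤ a → a ≤ d → a + d ≤ b → j < b →
  2 * s + d * suc d ≤ 2 * d * m →
  2 * R + a * b ≡ 2 * b * (suc m + i) + a * b * b →
  2 * C + 1 * a ≡ 2 * a * (suc m + a * j) + 1 * a * a →
  d + s + C < R
row-exceeds-column {m = m} {i} {j} {s} {R} {C} (s≤s {n = x} z≤n) a≤d a+d≤b j<b 2s≤ rowEq colEq
  with t , refl ← ℕ.m≤n⇒∃[o]m+o≡n a≤d
  with r , refl ← ℕ.m≤n⇒∃[o]m+o≡n a+d≤b =
  ℕ.*-cancelˡ-< 2 _ _ (ℕ.+-cancelʳ-≤ K _ _ (begin
    suc (2 * (d + s + C)) + K
      ≡⟨ alg₁ a b d s C ⟩
    (2 * s + d * suc d) + (2 * C + 1 * a) + (2 * a * a + 2 * d + a * b + 1)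
      ≡⟨ cong (λ z → (2 * s + d * suc d) + z + (2 * a * a + 2 * d + a * b + 1)) colEq ⟩
    (2 * s + d * suc d) + (2 * a * (suc m + a * j) + 1 * a * a) + (2 * a * a + 2 * d + a * b + 1)
      ≡⟨ alg₂ a b d j m s ⟩
    (2 * s + d * suc d) + 2 * a * a * suc j + (2 * a * suc m + a * a + 2 * d + a * b + 1)
      ≤⟨ ℕ.+-monoˡ-≤ _ (ℕ.+-mono-≤ 2s≤ (ℕ.*-monoʳ-≤ (2 * a * a) j<b)) ⟩
    2 * d * m + 2 * a * a * b + (2 * a * suc m + a * a + 2 * d + a * b + 1)
      ≤⟨ ℕ.m≤m+n _ _ ⟩
    2 * d * m + 2 * a * a * b + (2 * a * suc m + a * a + 2 * d + a * b + 1) + _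
      ≡⟨ alg₃ x t r m i ⟩
    (2 * b * (suc m + i) + a * b * b) + (d * suc d + a + 2 * a * a)
      ≡⟨ cong (_+ (d * suc d + a + 2 * a * a)) rowEq ⟨
    (2 * R + a * b) + (d * suc d + a + 2 * a * a)
      ≡⟨ alg₄ a b d R ⟩
    2 * R + K ∎))
  where
  open ℕ.≤-Reasoning
  a = suc x
  d = suc x + t
  b = suc x + (suc x + t) + r
  K = a * b + d * suc d + a + 2 * a * a
  alg₁ : ∀ a b d s C → suc (2 * (d + s + C)) + (a * b + d * suc d + a + 2 * a * a) ≡
         (2 * s + d * suc d) + (2 * C + 1 * a) + (2 * a * a + 2 * d + a * b + 1)
  alg₁ = solve-∀
  alg₂ : ∀ a b d j m s →
    (2 * s + d * suc d) + (2 * a * (suc m + a * j) + 1 * a * a) + (2 * a * a + 2 * d + a * b + 1) ≡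
    (2 * s + d * suc d) + 2 * a * a * suc j + (2 * a * suc m + a * a + 2 * d + a * b + 1)
  alg₂ = solve-∀
  -- The bracketed summand is the slack of the inequality: in the variables x, t, r
  -- it has nonnegative coefficients only.
  alg₃ : ∀ x t r m i → let a = suc x ; d = suc x + t ; b = suc x + (suc x + t) + r in
    2 * d * m + 2 * a * a * b + (2 * a * suc m + a * a + 2 * d + a * b + 1) +
      (2 * r * m + 1 + 2 * x + t + 2 * r + (1 + x) * (t + r) * (1 + 2 * x)
        + (1 + x) * (t + r) * (t + r) + 2 * (1 + x) * t + t * t + 2 * b * i) ≡
    (2 * b * (suc m + i) + a * b * b) + (d * suc d + a + 2 * a * a)
  alg₃ = solve-∀
  alg₄ : ∀ a b d R → (2 * R + a * b) + (d * suc d + a + 2 * a * a) ≡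
                     2 * R + (a * b + d * suc d + a + 2 * a * a)
  alg₄ = solve-∀

sum-map-suc : ∀ xs → sum (map suc xs) ≡ length xs + sum xs
sum-map-suc [] = refl
sum-map-suc (x ∷ xs) = cong suc (trans (cong (x +_) (sum-map-suc xs)) (alg x (length xs) (sum xs)))
  where
  alg : ∀ x l s → x + (l + s) ≡ l + (x + s)
  alg = solve-∀

third : ∀ {k} (c d : Fin (3 + k)) → c ≢ d → ∃ λ e → e ≢ c × e ≢ d
third c d c≢d = punchIn c (punchIn p Fin.zero) , Fin.punchInᵢ≢i c _ , λ eq →
  Fin.punchInᵢ≢i p Fin.zero (Fin.punchIn-injective c _ _ (trans eq (sym (Fin.punchIn-punchOut c≢d))))
  where p = punchOut c≢d

module Labelling {n k} (G : Graph n) (class : Fin n → Fin k)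
  (adj⇔ : ∀ u v → Adj G u v ⇔ class u ≢ class v) (c₀ : Fin k) where

  adj⁺ : ∀ {u v} → class u ≢ class v → Adj G u v
  adj⁺ = Equivalence.from (adj⇔ _ _)

  adj⁻ : ∀ {u v} → Adj G u v → class u ≢ class v
  adj⁻ = Equivalence.to (adj⇔ _ _)

  members : Fin k → List (Fin n)
  members c = filter (λ v → class v Fin.≟ c) (allFin n)

  ∈-members : ∀ {c v} → class v ≡ c → v ∈ members c
  ∈-members = ∈-filter⁺ _ (∈-allFin _)

  members-class : ∀ {c v} → v ∈ members c → class v ≡ c
  members-class {c} v∈ = proj₂ (∈-filter⁻ (λ v → class v Fin.≟ c) {xs = allFin n} v∈)

  members-unique : ∀ c → Unique (members c)
  members-unique c = Unique.filter⁺ _ (Unique.allFin⁺ n)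

  Avoids : Edge G → Set
  Avoids e = class (lo e) ≢ c₀ × class (hi e) ≢ c₀

  avoids? : Decidable Avoids
  avoids? e = ¬? (class (lo e) Fin.≟ c₀) ×-dec ¬? (class (hi e) Fin.≟ c₀)

  abstract
    avoiding : List (Edge G)
    avoiding = filter avoids? (edges G)

    avoiding-unique : Unique avoiding
    avoiding-unique = Unique.filter⁺ avoids? (edges-unique G)

    ∈-avoiding⁺ : ∀ {e} → Avoids e → e ∈ avoiding
    ∈-avoiding⁺ = ∈-filter⁺ avoids? (edges-complete G _)

    ∈-avoiding⁻ : ∀ {e} → e ∈ avoiding → Avoids e
    ∈-avoiding⁻ e∈ = proj₂ (∈-filter⁻ avoids? {xs = edges G} e∈)

  m : ℕ
  m = length avoiding

  avoiding-edge : Fin m → Edge G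
  avoiding-edge = lookup avoiding

  abstract
    avoiding-index : ∀ e → Avoids e → ∃ λ t → e ≡ avoiding-edge t
    avoiding-index e av = index (∈-avoiding⁺ av) , lookup-index (∈-avoiding⁺ av)

  avoiding-class : ∀ t {v} → Incident v (avoiding-edge t) → class v ≢ c₀
  avoiding-class t i with ∈-avoiding⁻ (∈-lookup {xs = avoiding} t) | i
  ... | p , _ | inj₁ refl = p
  ... | _ , q | inj₂ refl = q

  avoids : ∀ {u v} → class u ≢ c₀ → class v ≢ c₀ → u ≢ v →
           ∀ e → Incident u e → Incident v e → Avoids e
  avoids u∉A v∉A u≢v e u-e v-e = end (inj₁ refl) , end (inj₂ refl)
    where
    end : ∀ {w} → Incident w e → class w ≢ c₀
    end w-e with incident-ends G e u≢v u-e v-e w-e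
    ... | inj₁ refl = u∉A
    ... | inj₂ refl = v∉A

  incident-indices : Fin n → List (Fin m)
  incident-indices v = filter (λ t → incident? v (avoiding-edge t)) (allFin m)

  ∈-incident⁺ : ∀ {v t} → Incident v (avoiding-edge t) → t ∈ incident-indices v
  ∈-incident⁺ = ∈-filter⁺ _ (∈-allFin _)

  ∈-incident⁻ : ∀ {v t} → t ∈ incident-indices v → Incident v (avoiding-edge t)
  ∈-incident⁻ {v} t∈ = proj₂ (∈-filter⁻ (λ t → incident? v (avoiding-edge t)) {xs = allFin m} t∈)

  incident-unique : ∀ v → Unique (incident-indices v)
  incident-unique v = Unique.filter⁺ _ (Unique.allFin⁺ m)

  partialSum : Fin n → ℕ
  partialSum v = sum (map (suc ∘ toℕ) (incident-indices v))

  byPartialSum : DecTotalOrder _ _ _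
  byPartialSum = On.decTotalOrder ℕ.≤-decTotalOrder partialSum

  As : List (Fin n)
  As = members c₀

  abstract
    Bs : List (Fin n)
    Bs = Sort.sort byPartialSum (filter (λ v → ¬? (class v Fin.≟ c₀)) (allFin n))

    Bs-↭ : Bs ↭ filter (λ v → ¬? (class v Fin.≟ c₀)) (allFin n)
    Bs-↭ = Sort.sort-↭ byPartialSum _

    Bs-sorted : Sorted (DecTotalOrder.totalOrder byPartialSum) Bs
    Bs-sorted = Sort.sort-↗ byPartialSum _

    ∈-Bs⁺ : ∀ {v} → class v ≢ c₀ → v ∈ Bs
    ∈-Bs⁺ v∉ = ∈-resp-↭ (↭-sym Bs-↭) (∈-filter⁺ _ (∈-allFin _) v∉)

    ∈-Bs⁻ : ∀ {v} → v ∈ Bs → class v ≢ c₀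
    ∈-Bs⁻ v∈ = proj₂ (∈-filter⁻ (λ v → ¬? (class v Fin.≟ c₀)) {xs = allFin n} (∈-resp-↭ Bs-↭ v∈))

    Bs-unique : Unique Bs
    Bs-unique = Unique-resp-↭ (↭-sym Bs-↭) (Unique.filter⁺ _ (Unique.allFin⁺ n))

  a b : ℕ
  a = length As
  b = length Bs

  α : Fin a → Fin n
  α = lookup As

  β : Fin b → Fin n
  β = lookup Bs

  α-class : ∀ i → class (α i) ≡ c₀
  α-class i = members-class (∈-lookup {xs = As} i)

  β-class : ∀ j → class (β j) ≢ c₀
  β-class j = ∈-Bs⁻ (∈-lookup {xs = Bs} j)

  abstract
    α-index : ∀ {v} → class v ≡ c₀ → ∃ λ i → v ≡ α i
    α-index v∈ = _ , lookup-index (∈-members v∈)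

    β-index : ∀ {v} → class v ≢ c₀ → ∃ λ j → v ≡ β j
    β-index v∉ = _ , lookup-index (∈-Bs⁺ v∉)

  β≢α : ∀ {j i} → β j ≢ α i
  β≢α {j} {i} eq = β-class j (trans (cong class eq) (α-class i))

  partialSum-mono : ∀ {j j′} → toℕ j ≤ toℕ j′ → partialSum (β j) ≤ partialSum (β j′)
  partialSum-mono = lookup-mono-≤ (DecTotalOrder.totalOrder byPartialSum) Bs-sorted

  Code : Set
  Code = Fin m ⊎ (Fin b × Fin a)

  abstract
    cross : ∀ j i → Σ (Edge G) λ e → Incident (β j) e × Incident (α i) e
    cross j i = edge-between G _ _ (adj⁺ λ eq → β-class j (trans eq (α-class i)))

  decode : Code → Edge G
  decode (inj₁ t)       = avoiding-edge t
  decode (inj₂ (j , i)) = proj₁ (cross j i)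

  β-incident : ∀ j i → Incident (β j) (decode (inj₂ (j , i)))
  β-incident j i = proj₁ (proj₂ (cross j i))

  α-incident : ∀ j i → Incident (α i) (decode (inj₂ (j , i)))
  α-incident j i = proj₂ (proj₂ (cross j i))

  cross-ends : ∀ j i {v} → Incident v (decode (inj₂ (j , i))) → v ≡ β j ⊎ v ≡ α i
  cross-ends j i = incident-ends G (proj₁ (cross j i)) β≢α (β-incident j i) (α-incident j i)

  β-incident⁻ : ∀ {j j′ i} → Incident (β j) (decode (inj₂ (j′ , i))) → j ≡ j′
  β-incident⁻ {j′ = j′} {i} inc with cross-ends j′ i inc
  ... | inj₁ eq = lookup-injective Bs-unique eq
  ... | inj₂ eq = contradiction eq β≢α

  α-incident⁻ : ∀ {j i i′} → Incident (α i) (decode (inj₂ (j , i′))) → i ≡ i′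
  α-incident⁻ {j} {i′ = i′} inc with cross-ends j i′ inc
  ... | inj₁ eq = contradiction (sym eq) β≢α
  ... | inj₂ eq = lookup-injective (members-unique c₀) eq

  decode-injective : Injective _≡_ _≡_ decode
  decode-injective {inj₁ t} {inj₁ t′} eq =
    cong inj₁ (lookup-injective avoiding-unique eq)
  decode-injective {inj₁ t} {inj₂ (j , i)} eq =
    contradiction (α-class i) (avoiding-class t (subst (Incident _) (sym eq) (α-incident j i)))
  decode-injective {inj₂ (j , i)} {inj₁ t} eq =
    contradiction (α-class i) (avoiding-class t (subst (Incident _) eq (α-incident j i)))
  decode-injective {inj₂ (j , i)} {inj₂ (j′ , i′)} eq = cong₂ (λ x y → inj₂ (x , y))
    (β-incident⁻ {i = i′} (subst (Incident _) eq (β-incident j i)))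
    (α-incident⁻ {j = j′} (subst (Incident _) eq (α-incident j i)))

  cross-surjective : ∀ {u v} (e : Edge G) → Incident u e → Incident v e →
                     class u ≢ c₀ → class v ≡ c₀ → ∃ λ x → e ≡ decode x
  cross-surjective e u∈ v∈ u∉A v∈A with j , refl ← β-index u∉A with i , refl ← α-index v∈A =
    inj₂ (j , i) , ends-unique G β≢α e _ u∈ v∈ (β-incident j i) (α-incident j i)

  abstract
    decode-surjective : ∀ e → ∃ λ x → e ≡ decode x
    decode-surjective e@(edge _ _ _ uv) = go (class (lo e) Fin.≟ c₀) (class (hi e) Fin.≟ c₀)
      where
      go : Dec (class (lo e) ≡ c₀) → Dec (class (hi e) ≡ c₀) → ∃ λ x → e ≡ decode x
      go (yes p) (yes q) = contradiction (trans p (sym q)) (adj⁻ (recompute (adj? G _ _) uv))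
      go (yes p) (no  q) = cross-surjective e (inj₂ refl) (inj₁ refl) q p
      go (no  p) (yes q) = cross-surjective e (inj₁ refl) (inj₂ refl) p q
      go (no  p) (no  q) = Product.map inj₁ (λ eq → eq) (avoiding-index e (p , q))

  decode↔ : Code ↔ Edge G
  decode↔ = mk↔ₛ′ decode (proj₁ ∘ decode-surjective) (λ e → sym (proj₂ (decode-surjective e)))
    (λ x → decode-injective (sym (proj₂ (decode-surjective (decode x)))))

  Fin↔Code : Fin (m + b * a) ↔ Code
  Fin↔Code = ↔-trans Fin.+↔⊎ (↔-refl ⊎-↔ Fin.*↔×)

  φ : Edge G ↔ Fin (m + b * a)
  φ = ↔-sym (↔-trans Fin↔Code decode↔)

  label : Edge G → ℕ
  label = suc ∘ toℕ ∘ Inverse.to φ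

  label-decode : ∀ x → label (decode x) ≡ suc (toℕ (Inverse.from Fin↔Code x))
  label-decode x = cong (suc ∘ toℕ ∘ Inverse.from Fin↔Code) (Inverse.strictlyInverseʳ decode↔ x)

  label-avoiding : ∀ t → label (decode (inj₁ t)) ≡ suc (toℕ t)
  label-avoiding t = trans (label-decode (inj₁ t)) (cong suc (Fin.toℕ-↑ˡ t (b * a)))

  label-cross : ∀ j i → label (decode (inj₂ (j , i))) ≡ suc m + (a * toℕ j + toℕ i)
  label-cross j i = trans (label-decode (inj₂ (j , i)))
    (cong suc (trans (Fin.toℕ-↑ʳ m (combine j i)) (cong (m +_) (Fin.toℕ-combine j i))))

  rowSum : Fin a → ℕ
  rowSum i = sum (map (λ j → (suc m + toℕ i) + a * toℕ j) (allFin b))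

  columnSum : Fin b → ℕ
  columnSum j = sum (map (λ i → (suc m + a * toℕ j) + 1 * toℕ i) (allFin a))

  vertexSum-α : ∀ i → vertexSum G label (α i) ≡ rowSum i
  vertexSum-α i = trans
    (vertexSum-reindex G decode decode-injective decode-surjective label (α i) codes
      (Unique.map⁺ (λ { refl → refl }) (Unique.allFin⁺ b)) sound complete)
    (cong sum (trans (sym (map-∘ (allFin b))) (map-cong labels (allFin b))))
    where
    codes = map (λ j → inj₂ (j , i)) (allFin b)
    sound : ∀ {x} → x ∈ codes → Incident (α i) (decode x)
    sound x∈ with j , _ , refl ← ∈-map⁻ _ x∈ = α-incident j i
    complete : ∀ {x} → Incident (α i) (decode x) → x ∈ codes
    complete {inj₁ t} inc = contradiction (α-class i) (avoiding-class t inc)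
    complete {inj₂ (j , i′)} inc with refl ← α-incident⁻ {j = j} inc = ∈-map⁺ _ (∈-allFin j)
    alg : ∀ m i q → suc m + (q + i) ≡ suc m + i + q
    alg = solve-∀
    labels : ∀ j → label (decode (inj₂ (j , i))) ≡ (suc m + toℕ i) + a * toℕ j
    labels j = trans (label-cross j i) (alg m (toℕ i) (a * toℕ j))

  vertexSum-β : ∀ j → vertexSum G label (β j) ≡ partialSum (β j) + columnSum j
  vertexSum-β j = begin
    vertexSum G label (β j)
      ≡⟨ vertexSum-reindex G decode decode-injective decode-surjective label (β j) (codes₁ ++ codes₂)
           (Unique.++⁺ (Unique.map⁺ (λ { refl → refl }) (incident-unique (β j)))
                       (Unique.map⁺ (λ { refl → refl }) (Unique.allFin⁺ a)) disjoint) sound complete ⟩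
    sum (map (label ∘ decode) (codes₁ ++ codes₂))
      ≡⟨ cong sum (map-++ (label ∘ decode) codes₁ codes₂) ⟩
    sum (map (label ∘ decode) codes₁ ++ map (label ∘ decode) codes₂)
      ≡⟨ sum-++ (map (label ∘ decode) codes₁) _ ⟩
    sum (map (label ∘ decode) codes₁) + sum (map (label ∘ decode) codes₂)
      ≡⟨ cong₂ (λ xs ys → sum xs + sum ys)
           (trans (sym (map-∘ (incident-indices (β j)))) (map-cong label-avoiding _))
           (trans (sym (map-∘ (allFin a))) (map-cong labels (allFin a))) ⟩
    partialSum (β j) + columnSum j ∎
    where
    open ≡-Reasoning
    codes₁ codes₂ : List Code
    codes₁ = map inj₁ (incident-indices (β j))
    codes₂ = map (λ i → inj₂ (j , i)) (allFin a)
    disjoint : ∀ {x} → ¬ (x ∈ codes₁ × x ∈ codes₂)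
    disjoint (x∈ , x∈′) with _ , _ , refl ← ∈-map⁻ _ x∈ with _ , _ , () ← ∈-map⁻ _ x∈′
    sound : ∀ {x} → x ∈ codes₁ ++ codes₂ → Incident (β j) (decode x)
    sound x∈ with ∈-++⁻ codes₁ x∈
    ... | inj₁ x∈₁ with t , t∈ , refl ← ∈-map⁻ _ x∈₁ = ∈-incident⁻ t∈
    ... | inj₂ x∈₂ with i , _ , refl ← ∈-map⁻ _ x∈₂ = β-incident j i
    complete : ∀ {x} → Incident (β j) (decode x) → x ∈ codes₁ ++ codes₂
    complete {inj₁ t} inc = ∈-++⁺ˡ (∈-map⁺ _ (∈-incident⁺ inc))
    complete {inj₂ (j′ , i)} inc with refl ← β-incident⁻ {i = i} inc =
      ∈-++⁺ʳ codes₁ (∈-map⁺ _ (∈-allFin i))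
    alg : ∀ m i q → suc m + (q + i) ≡ suc m + q + 1 * i
    alg = solve-∀
    labels : ∀ i → label (decode (inj₂ (j , i))) ≡ (suc m + a * toℕ j) + 1 * toℕ i
    labels i = trans (label-cross j i) (alg m (toℕ i) (a * toℕ j))

  rowSum-injective : Fin b → Injective _≡_ _≡_ rowSum
  rowSum-injective j₀ {i} {i′} eq = Fin.toℕ-injective (ℕ.+-cancelˡ-≡ (suc m) _ _
    (ℕ.*-cancelˡ-≡ _ _ (2 * b) (ℕ.+-cancelʳ-≡ (a * b * b) _ _
      (trans (sym (sum-arithmetic b (suc m + toℕ i) a))
        (trans (cong (λ s → 2 * s + a * b) eq) (sum-arithmetic b (suc m + toℕ i′) a))))))
    where instance
      2b≢0 : ℕ.NonZero (2 * b)
      2b≢0 = ℕ.m*n≢0 2 b ⦃ _ ⦄ ⦃ Fin.nonZeroIndex j₀ ⦄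

  columnSum-< : Fin a → ∀ {j j′} → toℕ j < toℕ j′ → columnSum j < columnSum j′
  columnSum-< i₀ {j} {j′} j<j′ = ℕ.*-cancelˡ-< 2 _ _ (ℕ.+-cancelʳ-< (1 * a) _ _
    (subst₂ _<_ (sym (sum-arithmetic a _ 1)) (sym (sum-arithmetic a _ 1))
      (ℕ.+-monoˡ-< (1 * a * a) (ℕ.*-monoʳ-< (2 * a) (ℕ.+-monoʳ-< (suc m) (ℕ.*-monoʳ-< a j<j′))))))
    where instance
      a≢0 : ℕ.NonZero a
      a≢0 = Fin.nonZeroIndex i₀
      2a≢0 : ℕ.NonZero (2 * a)
      2a≢0 = ℕ.m*n≢0 2 a

  degree : Fin n → ℕ
  degree v = length (incident-indices v)

  partialSum-bound : ∀ v → ∃ λ s →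
    partialSum v ≡ degree v + s × 2 * s + degree v * suc (degree v) ≤ 2 * degree v * m
  partialSum-bound v = sum is , eq , bound
    where
    is = map toℕ (incident-indices v)
    len : length is ≡ degree v
    len = length-map toℕ (incident-indices v)
    eq : partialSum v ≡ degree v + sum is
    eq = trans (cong sum (map-∘ (incident-indices v)))
      (trans (sum-map-suc is) (cong (_+ sum is) len))
    bound = subst (λ l → 2 * sum is + l * suc l ≤ 2 * l * m) len
      (sum-unique-bounded m (Unique.map⁺ Fin.toℕ-injective (incident-unique v))
        (map⁺ (All.universal Fin.toℕ<n (incident-indices v))))

  module _ (minimal : ∀ c → a ≤ length (members c)) where

    a≤degree : ∀ {v c} → c ≢ c₀ → c ≢ class v → class v ≢ c₀ → a ≤ degree v
    a≤degree {v} {c} c≢c₀ c≢v v∉A = ℕ.≤-trans (minimal c)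
      (length-≤ R (members-unique c) edge-to λ (u , w , u≢v) (u′ , _ , u′≢v) →
        R-injective u w u′ u≢v u′≢v)
      where
      R : Fin n → Fin m → Set
      R u t = Incident u (avoiding-edge t) × Incident v (avoiding-edge t) × u ≢ v

      R-injective : ∀ {u u′ t} → Incident u (avoiding-edge t) → Incident v (avoiding-edge t) →
                    Incident u′ (avoiding-edge t) → u ≢ v → u′ ≢ v → u ≡ u′
      R-injective {t = t} u w u′ u≢v u′≢v with incident-ends G (avoiding-edge t) u≢v u w u′
      ... | inj₁ eq = sym eq
      ... | inj₂ eq = contradiction eq u′≢v

      edge-to : ∀ {u} → u ∈ members c → ∃ λ t → t ∈ incident-indices v × R u t
      edge-to {u} u∈ with refl ← members-class u∈
        with e , u-e , v-e ← edge-between G u v (adj⁺ c≢v)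
        with t , refl ← avoiding-index e (avoids c≢c₀ v∉A (c≢v ∘ cong class) e u-e v-e) =
        t , ∈-incident⁺ v-e , u-e , v-e , λ { refl → c≢v refl }

    a+degree≤b : ∀ {v} → class v ≢ c₀ → a + degree v ≤ b
    a+degree≤b {v} v∉A = subst (a + degree v ≤_) (length-filter-complement same? Bs)
      (ℕ.+-mono-≤
        (ℕ.≤-trans (minimal (class v))
          (length-≤ _≡_ (members-unique (class v))
            (λ {u} u∈ → let u∼v = members-class u∈ in
              u , ∈-filter⁺ same? (∈-Bs⁺ λ u∈A → v∉A (trans (sym u∼v) u∈A)) u∼v , refl)
            λ { refl refl → refl }))
        (length-≤ R (incident-unique v) neighbour λ (u , w , u≢v) (u′ , w′ , _) →
          lookup-injective avoiding-unique
            (ends-unique G u≢v _ _ u w u′ w′)))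
      where
      same? : Decidable (λ u → class u ≡ class v)
      same? u = class u Fin.≟ class v

      R : Fin m → Fin n → Set
      R t u = Incident u (avoiding-edge t) × Incident v (avoiding-edge t) × u ≢ v

      neighbour : ∀ {t} → t ∈ incident-indices v → ∃ λ u → u ∈ filter (¬? ∘ same?) Bs × R t u
      neighbour {t} t∈ with u , u-t , uv ← incident-other G (avoiding-edge t) (∈-incident⁻ t∈) =
        u , ∈-filter⁺ (¬? ∘ same?) (∈-Bs⁺ (avoiding-class t u-t)) (adj⁻ uv)
          , u-t , ∈-incident⁻ t∈ , λ { refl → adj⁻ uv refl }

    column<row : (∀ c d → c ≢ d → ∃ λ e → e ≢ c × e ≢ d) →
                 ∀ i j → vertexSum G label (β j) < vertexSum G label (α i)
    column<row third i j
      with c , c≢c₀ , c≢v ← third c₀ (class (β j)) (β-class j ∘ sym)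
      with s , eq , bound ← partialSum-bound (β j) =
      subst₂ _<_ (sym (trans (vertexSum-β j) (cong (_+ columnSum j) eq))) (sym (vertexSum-α i))
        (row-exceeds-column (ℕ.>-nonZero⁻¹ a ⦃ Fin.nonZeroIndex i ⦄)
          (a≤degree c≢c₀ c≢v (β-class j)) (a+degree≤b (β-class j)) (Fin.toℕ<n j) bound
          (sum-arithmetic b (suc m + toℕ i) a) (sum-arithmetic a (suc m + a * toℕ j) 1))

    sums-injective : (∀ c d → c ≢ d → ∃ λ e → e ≢ c × e ≢ d) → Fin a → Fin b →
                     Injective _≡_ _≡_ (vertexSum G label)
    sums-injective third i₀ j₀ {u} {v} eq with class u Fin.≟ c₀ | class v Fin.≟ c₀
    ... | yes p | yes q with i , refl ← α-index p with i′ , refl ← α-index q =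
      cong α (rowSum-injective j₀ (trans (sym (vertexSum-α i)) (trans eq (vertexSum-α i′))))
    ... | yes p | no  q with i , refl ← α-index p with j , refl ← β-index q =
      contradiction (sym eq) (ℕ.<⇒≢ (column<row third i j))
    ... | no  p | yes q with j , refl ← β-index p with i , refl ← α-index q =
      contradiction eq (ℕ.<⇒≢ (column<row third i j))
    ... | no  p | no  q with j , refl ← β-index p with j′ , refl ← β-index q = go (Fin.<-cmp j j′)
      where
      eq′ = trans (sym (vertexSum-β j)) (trans eq (vertexSum-β j′))
      go : Tri (j Fin.< j′) (j ≡ j′) (j′ Fin.< j) → β j ≡ β j′
      go (tri< j<j′ _ _) = contradiction eq′ (ℕ.<⇒≢
        (ℕ.+-mono-≤-< (partialSum-mono (ℕ.<⇒≤ j<j′)) (columnSum-< i₀ j<j′)))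
      go (tri≈ _ refl _) = refl
      go (tri> _ _ j′<j) = contradiction (sym eq′) (ℕ.<⇒≢
        (ℕ.+-mono-≤-< (partialSum-mono (ℕ.<⇒≤ j′<j)) (columnSum-< i₀ j′<j)))

smallest : ∀ {k} (f : Fin (suc k) → ℕ) → ∃ λ c → ∀ d → f c ≤ f d
smallest f = argmin f Fin.zero (allFin _) , λ d →
  All.lookup (f[argmin]≤f[xs] {f = f} Fin.zero (allFin _)) (∈-allFin d)

lemma5p2 : (n : ℕ) (G : Graph n) (k : ℕ) → k ≥ 3 → CompletePartite k G → Antimagic G
lemma5p2 n G k@(suc (suc (suc _))) (s≤s (s≤s (s≤s z≤n))) (class , surjective , adj⇔) =
  antimagic-smallest (smallest (λ c → length (filter (λ v → class v Fin.≟ c) (allFin n))))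
  where
  antimagic-smallest :
    (∃ λ c₀ → ∀ c → length (filter (λ v → class v Fin.≟ c₀) (allFin n)) ≤
                    length (filter (λ v → class v Fin.≟ c) (allFin n))) → Antimagic G
  antimagic-smallest (c₀ , minimal) = antimagic G φ (sums-injective minimal third
    (proj₁ (α-index (proj₂ inhabitant₀))) (proj₁ (β-index (proj₂ inhabitant₁))))
    where
    open Labelling G class adj⇔ c₀

    inhabitant₀ : ∃ λ v → class v ≡ c₀
    inhabitant₀ = Product.map (λ v → v) (λ eq → eq refl) (surjective c₀)

    inhabitant₁ : ∃ λ v → class v ≢ c₀
    inhabitant₁ = Product.map (λ v → v)
      (λ eq v∈A → Fin.punchInᵢ≢i c₀ Fin.zero (trans (sym (eq refl)) v∈A))
      (surjective (punchIn c₀ Fin.zero))
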